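{- For every positive integer $n$, we have $$\frac{2^{n-1}}{n}\leq \mu_t(Q_n)\leq \frac{2^n}{n}.$$ If $n=2^m-1$ for some positive integer $m$, then $$\frac{2^n}{n+1}\leq \mu_t(Q_n)\leq \frac{2^n}{n}.$$
   Context: For a positive integer $n$, write $[n]=\{1,\dots,n\}$. The $n$-dimensional hypercube $Q_n$ is the graph on the vertex set $2^{[n]}$ (all subsets of $[n]$), where $A,B\in 2^{[n]}$ are adjacent if and only if $|A\Delta B|=1$, with $A\Delta B=(A\setminus B)\cup(B\setminus A)$. Let $G$ be a simple graph and $M\subseteq V(G)$. Two vertices $u,v\in V(G)$ are $M$-visible if there exists a shortest $u,v$-path in $G$ that contains no vertices from $M\setminus\{u,v\}$. The set $M$ is a total mutual-visibility set if any two vertices $u,v\in V(G)$ are $M$-visible. The total mutual-visibility number $\mu_t(G)$ is the largest size of a total mutual-visibility set in $G$. -}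

module Defs where

open import Data.Fin.Subset using (Subset; _∪_; _─_; ∣_∣)
open import Data.Fin.Subset.Properties using (∪-comm)
open import Data.Bool.Base using (true; false)
open import Data.List.Base using (List; []; _∷_; length)
open import Data.List.Membership.Propositional using (_∈_)
open import Data.List.Relation.Unary.All using (All)
open import Data.List.Relation.Unary.Unique.Propositional using (Unique)
open import Data.Nat.Base using (ℕ; zero; suc; _≤_)
open import Data.Nat.Properties using (≤-antisym)
open import Data.Product.Base using (∃-syntax; _×_; _,_)
open import Data.Vec.Base using ([]; _∷_)
open import Relation.Binary.Construct.Closure.ReflexiveTransitive using (Star; ε; _◅_)
open import Relation.Binary.Definitions using (Symmetric; Irreflexive)
open import Relation.Binary.PropositionalEquality using (_≡_; _≢_; refl; sym; trans; cong)
open import Relation.Nullary.Negation using (¬_)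

record SimpleGraph : Set₁ where
  field
    Vertex  : Set
    Adj     : Vertex → Vertex → Set
    symm    : Symmetric Adj
    irrefl  : Irreflexive _≡_ Adj

module _ (G : SimpleGraph) where
  open SimpleGraph G

  Walk : Vertex → Vertex → Set
  Walk = Star Adj

  vertices : ∀ {u v} → Walk u v → List Vertex
  vertices {u} ε       = u ∷ []
  vertices {u} (_ ◅ w) = u ∷ vertices w

  -- Number of edges.
  walkLength : ∀ {u v} → Walk u v → ℕ
  walkLength ε       = zero
  walkLength (_ ◅ w) = suc (walkLength w)

  IsPath : ∀ {u v} → Walk u v → Set
  IsPath w = Unique (vertices w)

  IsShortestPath : ∀ {u v} → Walk u v → Set
  IsShortestPath {u} {v} p =
    IsPath p × (∀ (q : Walk u v) → IsPath q → walkLength p ≤ walkLength q)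

  -- A finite set M of vertices is given by a list of its elements; where
  -- its size matters, the list is required to be free of repetitions.
  Visible : List Vertex → Vertex → Vertex → Set
  Visible M u v =
    ∃[ p ] (IsShortestPath {u} {v} p ×
            All (λ x → ¬ (x ∈ M × x ≢ u × x ≢ v)) (vertices p))

  IsTotalMutualVisibilitySet : List Vertex → Set
  IsTotalMutualVisibilitySet M = ∀ u v → Visible M u v

  -- "μ is the total mutual-visibility number μₜ(G)", as a relation because
  -- a maximum need not be computable for an arbitrary graph.
  IsμT : ℕ → Set
  IsμT μ =
    (∃[ M ] (Unique M × IsTotalMutualVisibilitySet M × length M ≡ μ)) ×
    (∀ M → Unique M → IsTotalMutualVisibilitySet M → length M ≤ μ)

  IsμT-unique : ∀ {μ ν} → IsμT μ → IsμT ν → μ ≡ ν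
  IsμT-unique ((M , uM , tM , refl) , maxμ) ((N , uN , tN , refl) , maxν) =
    ≤-antisym (maxν M uM tM) (maxμ N uN tN)

infixl 6 _Δ_

_Δ_ : ∀ {n} → Subset n → Subset n → Subset n
A Δ B = (A ─ B) ∪ (B ─ A)

Δ-comm : ∀ {n} (A B : Subset n) → A Δ B ≡ B Δ A
Δ-comm A B = ∪-comm (A ─ B) (B ─ A)

∣AΔA∣≡0 : ∀ {n} (A : Subset n) → ∣ A Δ A ∣ ≡ 0
∣AΔA∣≡0 []          = refl
∣AΔA∣≡0 (true  ∷ A) = ∣AΔA∣≡0 A
∣AΔA∣≡0 (false ∷ A) = ∣AΔA∣≡0 A

-- The ground set [n] is Fin n.
Q : ℕ → SimpleGraph
Q n = record
  { Vertex = Subset n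
  ; Adj    = λ A B → ∣ A Δ B ∣ ≡ 1
  ; symm   = λ {A} {B} AB → trans (cong ∣_∣ (Δ-comm B A)) AB
  ; irrefl = λ { {A} refl AA → 0≢1 (trans (sym (∣AΔA∣≡0 A)) AA) }
  }
  where
  0≢1 : 0 ≢ 1
  0≢1 ()

{-# OPTIONS --safe #-}

-- M is a total mutual-visibility set of Qₙ exactly when every vertex has at
-- most one neighbour in M.  If C has two neighbours in M, then these are the
-- only common neighbours of C and some vertex at distance 2 from C.  Conversely,
-- a vertex at distance at least 2 from v has two neighbours closer to v, one of
-- them outside M, so a geodesic avoiding M can be chosen greedily.
--
-- Upper bound: the pairs (element of M, direction) inject into the vertices.
-- Lower bound: label the directions by distinct vectors of F₂ᵏ, where n ≤ 2ᵏ.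
-- Every vertex of Qₙ has at most one neighbour in each fibre of the linear map
-- summing the labels of a subset, and some fibre has at least 2ⁿ / 2ᵏ elements.
-- Take 2ᵏ ≤ 2n in general, and 2ᵏ = n + 1 if n = 2ᵐ − 1.

module Submission where

open import Defs
open import Data.Bool.Base using (Bool; true; false; not; _∧_; _xor_)
open import Data.Bool.Properties using (not-¬; not-distribˡ-xor) renaming (_≟_ to _≟ᵇ_)
open import Data.Fin.Base using (Fin; zero; suc; inject≤; remQuot)
open import Data.Fin.Properties as Fin
  using (2↔Bool; *↔×; injective⇒≤; inject≤-injective)
open import Data.Fin.Subset using (Subset; ∣_∣)
open import Data.Fin.Subset.Properties using (anySubset?)
open import Data.Integer.Base as ℤ using (+_)
open import Data.Integer.Properties using (pos-*)
open import Data.List.Base as List using (List; []; _∷_; length; filter; tabulate)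
open import Data.List.Membership.Propositional using (_∈_)
open import Data.List.Membership.Propositional.Properties using (∈-lookup; ∈-filter⁻)
open import Data.List.Properties using (length-tabulate)
open import Data.List.Relation.Unary.All as All using (All; []; _∷_)
open import Data.List.Relation.Unary.AllPairs using ([]; _∷_)
open import Data.List.Relation.Unary.Any using (here; there)
open import Data.List.Relation.Unary.Unique.Propositional using (Unique)
import Data.List.Relation.Unary.Unique.Propositional.Properties as Unique
import Data.List.Membership.DecPropositional as DecMembership
import Data.List.Relation.Unary.Unique.DecPropositional as DecUnique
open import Data.Nat.Base using (ℕ; zero; suc; _+_; _*_; _∸_; _^_; _≤_; z≤n; s≤s; NonZero)
open import Data.Nat.Properties
open import Data.Product.Base using (∃₂; ∃-syntax; _×_; _,_; proj₁; proj₂)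
open import Data.Product.Function.NonDependent.Propositional using (_×-↔_)
open import Data.Rational.Base as ℚ using (_/_) renaming (_≤_ to _≤ℚ_)
import Data.Rational.Properties as ℚ
import Data.Rational.Unnormalised.Base as ℚᵘ
import Data.Rational.Unnormalised.Properties as ℚᵘ
open import Data.Sum.Base using (_⊎_; inj₁; inj₂)
open import Data.Vec.Base using ([]; _∷_; updateAt; lookup)
open import Data.Vec.Properties
  using (≡-dec; lookup∘updateAt; lookup∘updateAt′; tabulate∘lookup; tabulate-cong)
open import Function.Base using (_∘_)
open import Function.Bundles using (_↔_; mk↔ₛ′; Inverse; Injection)
open import Function.Construct.Composition using (_↔-∘_)
open import Function.Construct.Symmetry using (↔-sym)
open import Function.Definitions using (Injective)
open import Function.Properties.Inverse using (↔⇒↣)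
open import Relation.Binary.Construct.Closure.ReflexiveTransitive using (ε; _◅_)
open import Relation.Binary.Definitions using (DecidableEquality)
open import Relation.Binary.PropositionalEquality
open import Relation.Nullary.Decidable
  using (Dec; yes; no; map′; ¬?; _×-dec_; _→-dec_; decidable-stable)
open import Relation.Nullary.Negation using (¬_; contradiction)
open import Relation.Unary using (Decidable)

private
  variable
    k n : ℕ
    X : Set

_≟ˢ_ : DecidableEquality (Subset n)
_≟ˢ_ = ≡-dec _≟ᵇ_

_∈?_ : (A : Subset n) (M : List (Subset n)) → Dec (A ∈ M)
_∈?_ = DecMembership._∈?_ _≟ˢ_

-- Hamming distance

toggle : Fin n → Subset n → Subset n
toggle i A = updateAt A i not

toggle-involutive : ∀ i (A : Subset n) → toggle i (toggle i A) ≡ A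
toggle-involutive zero    (true  ∷ A) = refl
toggle-involutive zero    (false ∷ A) = refl
toggle-involutive (suc i) (x     ∷ A) = cong (x ∷_) (toggle-involutive i A)

toggle-injective : ∀ (i : Fin n) {A B} → toggle i A ≡ toggle i B → A ≡ B
toggle-injective i {A} {B} eq =
  trans (sym (toggle-involutive i A)) (trans (cong (toggle i) eq) (toggle-involutive i B))

∣AΔB∣≡0⇒A≡B : (A B : Subset n) → ∣ A Δ B ∣ ≡ 0 → A ≡ B
∣AΔB∣≡0⇒A≡B []          []          _  = refl
∣AΔB∣≡0⇒A≡B (true  ∷ A) (true  ∷ B) eq = cong (true ∷_) (∣AΔB∣≡0⇒A≡B A B eq)
∣AΔB∣≡0⇒A≡B (false ∷ A) (false ∷ B) eq = cong (false ∷_) (∣AΔB∣≡0⇒A≡B A B eq)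
∣AΔB∣≡0⇒A≡B (true  ∷ A) (false ∷ B) ()
∣AΔB∣≡0⇒A≡B (false ∷ A) (true  ∷ B) ()

closer : (A B : Subset n) {d : ℕ} → ∣ A Δ B ∣ ≡ suc d → ∃[ i ] ∣ toggle i A Δ B ∣ ≡ d
closer []          []          ()
closer (true  ∷ A) (true  ∷ B) eq = let i , eq′ = closer A B eq in suc i , eq′
closer (false ∷ A) (false ∷ B) eq = let i , eq′ = closer A B eq in suc i , eq′
closer (true  ∷ A) (false ∷ B) eq = zero , suc-injective eq
closer (false ∷ A) (true  ∷ B) eq = zero , suc-injective eq

-- The two directions are the first coordinate where `A` and `B` differ and a later one supplied by
-- `closer`.
two-closer : (A B : Subset n) {d : ℕ} → ∣ A Δ B ∣ ≡ suc (suc d) →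
  ∃₂ λ i j → i ≢ j × ∣ toggle i A Δ B ∣ ≡ suc d × ∣ toggle j A Δ B ∣ ≡ suc d
two-closer []          []          ()
two-closer (true  ∷ A) (true  ∷ B) eq =
  let i , j , i≢j , eqᵢ , eqⱼ = two-closer A B eq
  in  suc i , suc j , i≢j ∘ Fin.suc-injective , eqᵢ , eqⱼ
two-closer (false ∷ A) (false ∷ B) eq =
  let i , j , i≢j , eqᵢ , eqⱼ = two-closer A B eq
  in  suc i , suc j , i≢j ∘ Fin.suc-injective , eqᵢ , eqⱼ
two-closer (true  ∷ A) (false ∷ B) eq =
  let j , eqⱼ = closer A B (suc-injective eq)
  in  zero , suc j , (λ ()) , suc-injective eq , cong suc eqⱼ
two-closer (false ∷ A) (true  ∷ B) eq =
  let j , eqⱼ = closer A B (suc-injective eq)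
  in  zero , suc j , (λ ()) , suc-injective eq , cong suc eqⱼ

∣AΔtoggle∣≡1 : ∀ i (A : Subset n) → ∣ A Δ toggle i A ∣ ≡ 1
∣AΔtoggle∣≡1 zero    (true  ∷ A) = cong suc (∣AΔA∣≡0 A)
∣AΔtoggle∣≡1 zero    (false ∷ A) = cong suc (∣AΔA∣≡0 A)
∣AΔtoggle∣≡1 (suc i) (true  ∷ A) = ∣AΔtoggle∣≡1 i A
∣AΔtoggle∣≡1 (suc i) (false ∷ A) = ∣AΔtoggle∣≡1 i A

∣AΔB∣≡1⇒toggle : (A B : Subset n) → ∣ A Δ B ∣ ≡ 1 → ∃[ i ] toggle i A ≡ B
∣AΔB∣≡1⇒toggle A B eq = let i , eq′ = closer A B eq in i , ∣AΔB∣≡0⇒A≡B (toggle i A) B eq′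

∣AΔB∣≤1+∣toggleΔB∣ : ∀ i (A B : Subset n) → ∣ A Δ B ∣ ≤ suc ∣ toggle i A Δ B ∣
∣AΔB∣≤1+∣toggleΔB∣ zero    (true  ∷ A) (true  ∷ B) = m≤n⇒m≤1+n (n≤1+n _)
∣AΔB∣≤1+∣toggleΔB∣ zero    (true  ∷ A) (false ∷ B) = ≤-refl
∣AΔB∣≤1+∣toggleΔB∣ zero    (false ∷ A) (true  ∷ B) = ≤-refl
∣AΔB∣≤1+∣toggleΔB∣ zero    (false ∷ A) (false ∷ B) = m≤n⇒m≤1+n (n≤1+n _)
∣AΔB∣≤1+∣toggleΔB∣ (suc i) (true  ∷ A) (true  ∷ B) = ∣AΔB∣≤1+∣toggleΔB∣ i A B
∣AΔB∣≤1+∣toggleΔB∣ (suc i) (true  ∷ A) (false ∷ B) = s≤s (∣AΔB∣≤1+∣toggleΔB∣ i A B)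
∣AΔB∣≤1+∣toggleΔB∣ (suc i) (false ∷ A) (true  ∷ B) = s≤s (∣AΔB∣≤1+∣toggleΔB∣ i A B)
∣AΔB∣≤1+∣toggleΔB∣ (suc i) (false ∷ A) (false ∷ B) = ∣AΔB∣≤1+∣toggleΔB∣ i A B

-- Each edge toggles one coordinate, which lowers the distance to `B` by at most one. This certifies
-- that the greedy paths are shortest.
∣AΔB∣≤walkLength : {A B : Subset n} (p : Walk (Q n) A B) → ∣ A Δ B ∣ ≤ walkLength (Q n) p
∣AΔB∣≤walkLength {A = A} ε = ≤-reflexive (∣AΔA∣≡0 A)
∣AΔB∣≤walkLength {A = A} {B} (_◅_ {j = C} AC p) with ∣AΔB∣≡1⇒toggle A C AC
... | i , refl = ≤-trans (∣AΔB∣≤1+∣toggleΔB∣ i A B) (s≤s (∣AΔB∣≤walkLength p))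

-- Total mutual-visibility sets

-- Neighbours are indexed by direction, so uniqueness becomes an equation in `Fin n`. Equivalently,
-- no two elements of `M` are at distance exactly 2.
AtMostOneNeighbour : List (Subset n) → Set
AtMostOneNeighbour M = ∀ C i j → toggle i C ∈ M → toggle j C ∈ M → i ≡ j

module _ {M : List (Subset n)} (M-sparse : AtMostOneNeighbour M) where

  -- The implication in the conclusion exempts `v`, which is where the step lands when `d` is zero.
  -- For larger `d` there are two closer neighbours, and sparsity keeps one of them out of `M`.
  greedy-step : ∀ {d} (u v : Subset n) → ∣ u Δ v ∣ ≡ suc d →
    ∃[ i ] (∣ toggle i u Δ v ∣ ≡ d × (toggle i u ∈ M → toggle i u ≡ v))
  greedy-step {zero} u v eq =
    let i , eqᵢ = closer u v eq
    in  i , eqᵢ , λ _ → ∣AΔB∣≡0⇒A≡B (toggle i u) v eqᵢ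
  greedy-step {suc d} u v eq with two-closer u v eq
  ... | i , j , i≢j , eqᵢ , eqⱼ with toggle i u ∈? M
  ...   | no  i∉M = i , eqᵢ , λ i∈M → contradiction i∈M i∉M
  ...   | yes i∈M = j , eqⱼ , λ j∈M → contradiction (M-sparse u i j i∈M j∈M) i≢j

  greedy-path : ∀ d (u v : Subset n) → ∣ u Δ v ∣ ≡ d →
    ∃[ p ] ( IsPath (Q n) {u} {v} p
           × walkLength (Q n) p ≡ d
           × All (λ x → ∣ x Δ v ∣ ≤ d) (vertices (Q n) p)
           × All (λ x → ¬ (x ∈ M × x ≢ u × x ≢ v)) (vertices (Q n) p))
  greedy-path zero u v eq with refl ← ∣AΔB∣≡0⇒A≡B u v eq =
    ε , ([] ∷ []) , refl , (≤-reflexive eq ∷ []) , ((λ (_ , u≢u , _) → u≢u refl) ∷ [])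
  greedy-path (suc d) u v eq =
    let i , eqᵢ , end                   = greedy-step u v eq
        p , simple , len , near , avoid = greedy-path d (toggle i u) v eqᵢ
    in  ∣AΔtoggle∣≡1 i u ◅ p
      -- The distance bound `near` keeps `u`, at distance `suc d` from `v`, off the rest of the
      -- path.
      , All.map (λ { x≤d refl → 1+n≰n (≤-trans (≤-reflexive (sym eq)) x≤d) }) near ∷ simple
      , cong suc len
      , ≤-reflexive eq ∷ All.map m≤n⇒m≤1+n near
      , (λ (_ , u≢u , _) → u≢u refl)
        -- The recursive path exempts its own start `toggle i u`; by `end`, that vertex lies in `M`
        -- only if it is `v`.
        ∷ All.map (λ ok (x∈M , _ , x≢v) → ok (x∈M , (λ { refl → x≢v (end x∈M) }) , x≢v)) avoid

  sparse⇒total : IsTotalMutualVisibilitySet (Q n) M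
  sparse⇒total u v =
    let p , simple , len , _ , avoid = greedy-path ∣ u Δ v ∣ u v refl
    in  p , (simple , λ q _ → ≤-trans (≤-reflexive len) (∣AΔB∣≤walkLength q)) , avoid

lookup-toggle₂ : ∀ {i j : Fin n} → i ≢ j → ∀ C →
                 lookup (toggle i (toggle j C)) i ≡ not (lookup C i)
lookup-toggle₂ {i = i} {j} i≢j C =
  trans (lookup∘updateAt i (toggle j C)) (cong not (lookup∘updateAt′ i j i≢j C))

toggle-≢ : ∀ i (C : Subset n) → toggle i C ≢ C
toggle-≢ i C eq = not-¬ refl (trans (cong (λ A → lookup A i) (sym eq)) (lookup∘updateAt i C))

toggle₂-≢ : ∀ {i j : Fin n} → i ≢ j → ∀ C → toggle i (toggle j C) ≢ C
toggle₂-≢ {i = i} i≢j C eq =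
  not-¬ refl (trans (cong (λ A → lookup A i) (sym eq)) (lookup-toggle₂ i≢j C))

-- The two sides differ at coordinate `i`, unless `a` is `i`; then cancelling `toggle i` would leave
-- `toggle j C ≡ C`.
toggle₂-≢-toggle : ∀ {i j : Fin n} → i ≢ j → ∀ a C → toggle i (toggle j C) ≢ toggle a C
toggle₂-≢-toggle {i = i} {j} i≢j a C eq with i Fin.≟ a
... | yes refl = toggle-≢ j C (toggle-injective i eq)
... | no  i≢a  = not-¬ (lookup∘updateAt′ i a i≢a C)
  (trans (cong (λ A → lookup A i) (sym eq)) (lookup-toggle₂ i≢j C))

-- If `a` differs from `i`, `j` and `b`, coordinate `a` is flipped on the right only. If `a` is `b`,
-- the right side collapses to `C`.
toggle₂-toggle₂ : ∀ {i j : Fin n} → i ≢ j → ∀ a b C →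
  toggle i (toggle j C) ≡ toggle b (toggle a C) → a ≡ i ⊎ a ≡ j
toggle₂-toggle₂ {i = i} {j} i≢j a b C eq with a Fin.≟ i | a Fin.≟ j | a Fin.≟ b
... | yes a≡i | _       | _        = inj₁ a≡i
... | no  _   | yes a≡j | _        = inj₂ a≡j
... | no  _   | no  _   | yes refl =
  contradiction (trans eq (toggle-involutive a C)) (toggle₂-≢ i≢j C)
... | no  a≢i | no  a≢j | no  a≢b  = contradiction
  (begin
    lookup C a                         ≡⟨ lookup∘updateAt′ a j a≢j C ⟨
    lookup (toggle j C) a              ≡⟨ lookup∘updateAt′ a i a≢i (toggle j C) ⟨
    lookup (toggle i (toggle j C)) a   ≡⟨ cong (λ A → lookup A a) eq ⟩
    lookup (toggle b (toggle a C)) a   ≡⟨ lookup∘updateAt′ a b a≢b (toggle a C) ⟩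
    lookup (toggle a C) a              ≡⟨ lookup∘updateAt a C ⟩
    not (lookup C a)                   ∎)
  (not-¬ refl)
  where open ≡-Reasoning

-- Walks of length 0 or 1 are too short to reach `v`, and one of length 2 must start in direction
-- `i` or `j`. The endpoint is a variable with an equation so that the walk can be matched on.
geodesic₂-middle : ∀ {i j : Fin n} → i ≢ j → ∀ {C v} → v ≡ toggle i (toggle j C) →
  (p : Walk (Q n) C v) → walkLength (Q n) p ≤ 2 →
  toggle i C ∈ vertices (Q n) p ⊎ toggle j C ∈ vertices (Q n) p
geodesic₂-middle i≢j {C} eq ε _ = contradiction (sym eq) (toggle₂-≢ i≢j C)
geodesic₂-middle i≢j {C} {v} eq (Cv ◅ ε) _ with ∣AΔB∣≡1⇒toggle C v Cv
... | a , refl = contradiction (sym eq) (toggle₂-≢-toggle i≢j a C)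
geodesic₂-middle i≢j {C} {v} eq (_◅_ {j = w} Cw (wv ◅ ε)) _
  with ∣AΔB∣≡1⇒toggle C w Cw
... | a , refl with ∣AΔB∣≡1⇒toggle w v wv
...   | b , refl with toggle₂-toggle₂ i≢j a b C (sym eq)
...     | inj₁ refl = inj₁ (there (here refl))
...     | inj₂ refl = inj₂ (there (here refl))
geodesic₂-middle _ _ (_ ◅ (_ ◅ (_ ◅ _))) (s≤s (s≤s ()))

-- Were `i` and `j` distinct, every shortest path from `C` to the opposite corner of the square they
-- span would pass through `toggle i C` or `toggle j C`, inner vertices that both lie in `M`.
total⇒sparse : {M : List (Subset n)} → IsTotalMutualVisibilitySet (Q n) M → AtMostOneNeighbour M
total⇒sparse {n} {M} total C i j i∈M j∈M with i Fin.≟ j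
... | yes i≡j = i≡j
... | no  i≢j with total C (toggle i (toggle j C))
...   | p , (_ , shortest) , avoid with geodesic₂-middle i≢j refl p (shortest q q-simple)
  where
  q : Walk (Q n) C (toggle i (toggle j C))
  q = ∣AΔtoggle∣≡1 j C ◅ (∣AΔtoggle∣≡1 i (toggle j C) ◅ ε)

  q-simple : IsPath (Q n) q
  q-simple = (≢-sym (toggle-≢ j C) ∷ ≢-sym (toggle₂-≢ i≢j C) ∷ [])
           ∷ (≢-sym (toggle-≢ i (toggle j C)) ∷ []) ∷ [] ∷ []
...     | inj₁ i∈p = contradiction
  (i∈M , toggle-≢ i C , ≢-sym (toggle-≢ j C) ∘ toggle-injective i) (All.lookup avoid i∈p)
...     | inj₂ j∈p = contradiction
  (j∈M , toggle-≢ j C , ≢-sym (toggle-≢ i (toggle j C))) (All.lookup avoid j∈p)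

-- Counting

Subset↔Fin : ∀ n → Subset n ↔ Fin (2 ^ n)
Subset↔Fin zero    = mk↔ₛ′ (λ _ → zero) (λ _ → []) (λ { zero → refl }) (λ { [] → refl })
Subset↔Fin (suc n) = ↔-sym *↔× ↔-∘ ((↔-sym 2↔Bool ×-↔ Subset↔Fin n) ↔-∘ uncons)
  where
  uncons : Subset (suc n) ↔ (Bool × Subset n)
  uncons = mk↔ₛ′ (λ { (x ∷ A) → x , A }) (λ (x , A) → x ∷ A) (λ _ → refl) (λ { (_ ∷ _) → refl })

encode : Subset n → Fin (2 ^ n)
encode = Inverse.to (Subset↔Fin _)

decode : Fin (2 ^ n) → Subset n
decode = Inverse.from (Subset↔Fin _)

encode-injective : Injective _≡_ _≡_ (encode {n})
encode-injective = Injection.injective (↔⇒↣ (Subset↔Fin _))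

decode-injective : Injective _≡_ _≡_ (decode {n})
decode-injective = Injection.injective (↔⇒↣ (↔-sym (Subset↔Fin _)))

lookup-injective : {xs : List X} → Unique xs → Injective _≡_ _≡_ (List.lookup xs)
lookup-injective (x∉ ∷ u) {zero}  {zero}  _  = refl
lookup-injective (x∉ ∷ u) {zero}  {suc j} eq = contradiction eq (All.lookup x∉ (∈-lookup j))
lookup-injective (x∉ ∷ u) {suc i} {zero}  eq = contradiction (sym eq) (All.lookup x∉ (∈-lookup i))
lookup-injective (x∉ ∷ u) {suc i} {suc j} eq = cong suc (lookup-injective u eq)

-- If two pairs (element of `M`, direction) lead to the same vertex, both elements are neighbours of
-- it in `M`; so the directions agree, and then the elements do.
sparse⇒length*n≤2^n : {M : List (Subset n)} → Unique M → AtMostOneNeighbour M →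
                      length M * n ≤ 2 ^ n
sparse⇒length*n≤2^n {n} {M} unique sparse = injective⇒≤ {f = f} f-injective
  where
  neighbour : Fin (length M) × Fin n → Subset n
  neighbour (a , i) = toggle i (List.lookup M a)

  neighbour-injective : Injective _≡_ _≡_ neighbour
  neighbour-injective {a , i} {b , j} eq with refl ← sparse (neighbour (a , i)) i j
    (subst (_∈ M) (sym (toggle-involutive i _)) (∈-lookup a))
    (subst (_∈ M) (trans (sym (toggle-involutive j _)) (cong (toggle j) (sym eq))) (∈-lookup b))
    = cong (_, i) (lookup-injective unique (toggle-injective i eq))

  f : Fin (length M * n) → Fin (2 ^ n)
  f = encode ∘ neighbour ∘ remQuot n

  f-injective : Injective _≡_ _≡_ f
  f-injective =
    Injection.injective (↔⇒↣ (*↔× {length M} {n})) ∘ neighbour-injective ∘ encode-injective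

m≤n⇒m+n≤2*n : ∀ {a b} → a ≤ b → a + b ≤ 2 * b
m≤n⇒m+n≤2*n {b = b} a≤b = +-mono-≤ a≤b (≤-reflexive (sym (+-identityʳ b)))

module _ (f : X → Bool) where

  fibre : Bool → List X → List X
  fibre b = filter (λ x → f x ≟ᵇ b)

  length-fibres : ∀ xs → length xs ≡ length (fibre true xs) + length (fibre false xs)
  length-fibres []       = refl
  length-fibres (x ∷ xs) with f x
  ... | true  = cong suc (length-fibres xs)
  ... | false = trans (cong suc (length-fibres xs)) (sym (+-suc _ _))

  large-fibre : ∀ xs → ∃[ b ] length xs ≤ 2 * length (fibre b xs)
  large-fibre xs with ≤-total (length (fibre true xs)) (length (fibre false xs))
  ... | inj₁ t≤f = false , ≤-trans (≤-reflexive (length-fibres xs)) (m≤n⇒m+n≤2*n t≤f)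
  ... | inj₂ f≤t = true  , ≤-trans
    (≤-reflexive (trans (length-fibres xs) (+-comm (length (fibre true xs)) _)))
    (m≤n⇒m+n≤2*n f≤t)

-- Each of the `k` functions in turn keeps the larger of its two fibres, so at most half of the list
-- is lost each time.
large-common-fibre : (fs : Fin k → X → Bool) (xs : List X) → Unique xs →
  ∃[ ys ] ( Unique ys
          × (∀ {y} → y ∈ ys → y ∈ xs)
          × (∀ c {y z} → y ∈ ys → z ∈ ys → fs c y ≡ fs c z)
          × length xs ≤ 2 ^ k * length ys)
large-common-fibre {zero}  fs xs unique =
  xs , unique , (λ y∈ → y∈) , (λ ()) , ≤-reflexive (sym (+-identityʳ _))
large-common-fibre {suc k} fs xs unique =
  let b , half = large-fibre (fs zero) xs
      value? = λ x → fs zero x ≟ᵇ b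
      ys , ys-unique , ys⊆ , ys-const , len =
        large-common-fibre (fs ∘ suc) (filter value? xs) (Unique.filter⁺ value? unique)
      value : ∀ {y} → y ∈ ys → fs zero y ≡ b
      value y∈ = proj₂ (∈-filter⁻ value? {xs = xs} (ys⊆ y∈))
  in  ys
    , ys-unique
    , (λ y∈ → proj₁ (∈-filter⁻ value? (ys⊆ y∈)))
    , (λ { zero    y∈ z∈ → trans (value y∈) (sym (value z∈))
         ; (suc c) y∈ z∈ → ys-const c y∈ z∈ })
    , ≤-trans half (≤-trans (*-monoʳ-≤ 2 len) (≤-reflexive (sym (*-assoc 2 (2 ^ k) (length ys)))))

-- Linear codes

-- The linear functional over F₂ with coefficients `b`, applied to the characteristic vector of the
-- subset.
parity : (Fin n → Bool) → Subset n → Bool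
parity b []      = false
parity b (x ∷ A) = (b zero ∧ x) xor parity (b ∘ suc) A

parity-toggle : ∀ b i (A : Subset n) → parity b (toggle i A) ≡ b i xor parity b A
parity-toggle b zero (x ∷ A) with b zero
... | true  = sym (not-distribˡ-xor x _)
... | false = refl
parity-toggle b (suc i) (x ∷ A) rewrite parity-toggle (b ∘ suc) i A with b zero ∧ x | b (suc i)
... | true  | true  = refl
... | true  | false = refl
... | false | _     = refl

xor-cancelʳ : ∀ x y z → x xor z ≡ y xor z → x ≡ y
xor-cancelʳ true  true  z     _  = refl
xor-cancelʳ false false z     _  = refl
xor-cancelʳ true  false true  ()
xor-cancelʳ true  false false ()
xor-cancelʳ false true  true  ()
xor-cancelʳ false true  false ()

lookup-ext : {A B : Subset n} → (∀ c → lookup A c ≡ lookup B c) → A ≡ B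
lookup-ext {A = A} {B} eq =
  trans (sym (tabulate∘lookup A)) (trans (tabulate-cong eq) (tabulate∘lookup B))

-- The labels are the columns of a parity-check matrix, so toggling `i` adds label `i` to the
-- syndrome. Two neighbours of `C` with equal syndromes therefore have equal labels, hence equal
-- directions.
large-sparse-set : ∀ k → n ≤ 2 ^ k →
  ∃[ M ] (Unique M × AtMostOneNeighbour {n} M × 2 ^ n ≤ 2 ^ k * length M)
large-sparse-set {n} k n≤2^k =
  let M , unique , _ , const , len =
        large-common-fibre (parity ∘ bit) (tabulate decode) (Unique.tabulate⁺ decode-injective)
  in  M , unique , sparse const , subst (_≤ 2 ^ k * length M) (length-tabulate (decode {n})) len
  where
  label : Fin n → Subset k
  label i = decode (inject≤ i n≤2^k)

  bit : Fin k → Fin n → Bool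
  bit c i = lookup (label i) c

  sparse : ∀ {M} → (∀ c {A B} → A ∈ M → B ∈ M → parity (bit c) A ≡ parity (bit c) B) →
           AtMostOneNeighbour M
  sparse const C i j i∈M j∈M = inject≤-injective _ _ i j (decode-injective (lookup-ext λ c →
    xor-cancelʳ (bit c i) (bit c j) (parity (bit c) C)
      (trans (sym (parity-toggle (bit c) i C))
        (trans (const c i∈M j∈M) (parity-toggle (bit c) j C)))))

-- Existence of the maximum

allSubset? : {P : Subset n → Set} → Decidable P → Dec (∀ A → P A)
allSubset? P? = map′ (λ ∄¬P A → decidable-stable (P? A) λ ¬PA → ∄¬P (A , ¬PA))
                     (λ ∀P (A , ¬PA) → ¬PA (∀P A))
                     (¬? (anySubset? (¬? ∘ P?)))

sparse? : Decidable (AtMostOneNeighbour {n})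
sparse? M = allSubset? λ C → Fin.all? λ i → Fin.all? λ j →
  (toggle i C ∈? M) →-dec ((toggle j C ∈? M) →-dec (i Fin.≟ j))

anyListOfLength? : ∀ l {P : List (Subset n) → Set} → Decidable P →
                   Dec (∃[ M ] (P M × length M ≡ l))
anyListOfLength? zero    P? =
  map′ (λ P[] → [] , P[] , refl) (λ { ([] , P[] , _) → P[] }) (P? [])
anyListOfLength? (suc l) P? =
  map′ (λ (A , M , PAM , eq) → A ∷ M , PAM , cong suc eq)
       (λ { (A ∷ M , PAM , eq) → A , M , PAM , suc-injective eq })
       (anySubset? λ A → anyListOfLength? l (P? ∘ (A ∷_)))

-- Search downwards from the bound; `P 0` guarantees a hit.
bounded-max : {P : ℕ → Set} → Decidable P → P 0 → ∀ b → (∀ {l} → P l → l ≤ b) →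
              ∃[ m ] (P m × (∀ {l} → P l → l ≤ m))
bounded-max P? P0 zero    bound = 0 , P0 , bound
bounded-max P? P0 (suc b) bound with P? (suc b)
... | yes P1+b = suc b , P1+b , bound
... | no ¬P1+b = bounded-max P? P0 b λ Pl →
  ≤-pred (≤∧≢⇒< (bound Pl) λ { refl → ¬P1+b Pl })

-- Visibility quantifies over walks, but the equivalent sparsity is a finite check, so the maximum
-- is found by searching lists of each length up to `2 ^ n`.
μT-exists : ∀ n .{{_ : NonZero n}} → ∃[ μ ] IsμT (Q n) μ
μT-exists n =
  let μ , (M , (unique , sparse) , len) , maximal = bounded-max
        (λ l → anyListOfLength? l λ M → DecUnique.unique? _≟ˢ_ M ×-dec sparse? M)
        ([] , ([] , (λ _ _ _ ())) , refl)
        (2 ^ n)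
        -- Since `n` is positive, the bound on `length M * n` also bounds `length M`.
        (λ (M , (unique , sparse) , len) → subst (_≤ 2 ^ n) len
          (≤-trans (m≤m*n (length M) n) (sparse⇒length*n≤2^n unique sparse)))
  in  μ , (M , unique , sparse⇒total sparse , len)
        , λ M′ unique′ total′ → maximal (M′ , (unique′ , total⇒sparse total′) , refl)

-- Bounds on μₜ(Qₙ)

μT*n≤2^n : ∀ {μ} → IsμT (Q n) μ → μ * n ≤ 2 ^ n
μT*n≤2^n ((M , unique , total , refl) , _) = sparse⇒length*n≤2^n unique (total⇒sparse total)

2^n≤2^k*μT : ∀ {μ} → IsμT (Q n) μ → ∀ k → n ≤ 2 ^ k → 2 ^ n ≤ 2 ^ k * μ
2^n≤2^k*μT {μ = μ} (_ , maximal) k n≤2^k =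
  let M , unique , sparse , large = large-sparse-set k n≤2^k
  in  ≤-trans large (*-monoʳ-≤ (2 ^ k) {length M} {μ} (maximal M unique (sparse⇒total sparse)))

-- The exponent grows only once `2 ^ k ≤ n`; a single doubling then suffices because `suc n ≤ 2 * n`
-- for positive `n`.
power-of-two-between : ∀ n .{{_ : NonZero n}} → ∃[ k ] (n ≤ 2 ^ k × 2 ^ k ≤ 2 * n)
power-of-two-between (suc zero) = 0 , s≤s z≤n , s≤s z≤n
power-of-two-between (suc n@(suc _)) with power-of-two-between n
... | k , n≤2^k , 2^k≤2n with n <? 2 ^ k
...   | yes n<2^k = k , n<2^k , ≤-trans 2^k≤2n (*-monoʳ-≤ 2 (n≤1+n n))
...   | no  n≮2^k = suc k
  , ≤-trans (m<m*n n 2 ≤-refl) (≤-trans (≤-reflexive (*-comm n 2)) (*-monoʳ-≤ 2 n≤2^k))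
  , *-monoʳ-≤ 2 (≤-trans (≮⇒≥ n≮2^k) (n≤1+n n))

-- `_/_` reduces to lowest terms, so cross-multiplication is carried out on unnormalised rationals,
-- whose denominators are stored minus one.
/-≤-/ : ∀ a c b d .{{_ : NonZero c}} .{{_ : NonZero d}} →
        a * d ≤ b * c → (+ a) / c ≤ℚ (+ b) / d
/-≤-/ a c@(suc c′) b d@(suc d′) ad≤bc = ℚ.toℚᵘ-cancel-≤ (begin
  ℚ.toℚᵘ ((+ a) / c)    ≃⟨ ℚ.toℚᵘ-fromℚᵘ (ℚᵘ.mkℚᵘ (+ a) c′) ⟩
  ℚᵘ.mkℚᵘ (+ a) c′      ≤⟨ ℚᵘ.*≤* (subst₂ ℤ._≤_ (pos-* a d) (pos-* b c) (ℤ.+≤+ ad≤bc)) ⟩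
  ℚᵘ.mkℚᵘ (+ b) d′      ≃⟨ ℚ.toℚᵘ-fromℚᵘ (ℚᵘ.mkℚᵘ (+ b) d′) ⟨
  ℚ.toℚᵘ ((+ b) / d)    ∎)
  where open ℚᵘ.≤-Reasoning

theorem1p7 : (n : ℕ) .{{_ : NonZero n}} →
    ∃[ μ ] ( IsμT (Q n) μ
    × (+ (2 ^ (n ∸ 1))) / n ≤ℚ (+ μ) / 1
    × (+ μ) / 1 ≤ℚ (+ (2 ^ n)) / n
    × ( (m : ℕ) .{{_ : NonZero m}} → n ≡ 2 ^ m ∸ 1 →
    ((+ (2 ^ n)) / suc n ≤ℚ (+ μ) / 1) × ((+ μ) / 1 ≤ℚ (+ (2 ^ n)) / n) ) )
theorem1p7 n@(suc n′) with μT-exists n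
... | μ , isμT = μ , isμT , lower , upper , λ m n≡2^m∸1 → perfect m n≡2^m∸1 , upper
  where
  open ≤-Reasoning

  upper : (+ μ) / 1 ≤ℚ (+ (2 ^ n)) / n
  upper = /-≤-/ μ 1 (2 ^ n) n (≤-trans (μT*n≤2^n isμT) (≤-reflexive (sym (*-identityʳ _))))

  lower : (+ (2 ^ n′)) / n ≤ℚ (+ μ) / 1
  lower =
    let k , n≤2^k , 2^k≤2n = power-of-two-between n
    -- Doubling both sides turns `2 ^ n′` into `2 ^ n` and makes room for `2 ^ k ≤ 2 * n`.
    in  /-≤-/ (2 ^ n′) n μ 1 (*-cancelˡ-≤ 2 (begin
      2 * (2 ^ n′ * 1)  ≡⟨ cong (2 *_) (*-identityʳ (2 ^ n′)) ⟩
      2 ^ n             ≤⟨ 2^n≤2^k*μT isμT k n≤2^k ⟩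
      2 ^ k * μ         ≤⟨ *-monoˡ-≤ μ 2^k≤2n ⟩
      2 * n * μ         ≡⟨ *-assoc 2 n μ ⟩
      2 * (n * μ)       ≡⟨ cong (2 *_) (*-comm n μ) ⟩
      2 * (μ * n)       ∎))

  -- With `k = m` the number of labels is exactly `suc n`, which avoids the factor lost in rounding
  -- up to a power of two.
  perfect : ∀ m → n ≡ 2 ^ m ∸ 1 → (+ (2 ^ n)) / suc n ≤ℚ (+ μ) / 1
  perfect m n≡2^m∸1 = /-≤-/ (2 ^ n) (suc n) μ 1 (begin
    2 ^ n * 1    ≡⟨ *-identityʳ (2 ^ n) ⟩
    2 ^ n        ≤⟨ 2^n≤2^k*μT isμT m (≤-trans (n≤1+n n) (≤-reflexive 1+n≡2^m)) ⟩
    2 ^ m * μ    ≡⟨ *-comm (2 ^ m) μ ⟩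
    μ * 2 ^ m    ≡⟨ cong (μ *_) 1+n≡2^m ⟨
    μ * suc n    ∎)
    where
    1+n≡2^m : suc n ≡ 2 ^ m
    -- Subtraction is truncated, so undoing it relies on `2 ^ m` being nonzero.
    1+n≡2^m = trans (cong suc n≡2^m∸1) (suc-pred (2 ^ m) {{m^n≢0 2 m}})
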